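{- Let $r\ge 3$ and let $k$ be an integer with $1\le k\le r$. Then $\mathrm{cov}(r,k)=1$.
   Context: A complete $r$-uniform $r$-partite hypergraph $K$ has a vertex set $V=V(K)$ partitioned into nonempty classes $V_1\cup\dots\cup V_r$, and its edges are exactly the sets containing one vertex from each class. A $k$-coloring of a hypergraph is an assignment of a color from $[k]=\{1,\dots,k\}$ to each edge (not all $k$ colors need be used). A coloring is spanning if every vertex is incident to edges of every color used in the coloring. For an edge-colored hypergraph $H$, let $H_i$ be the subhypergraph on vertex set $V(H)$ consisting of the edges of color $i$. A hypergraph is connected if it has only one vertex or any two distinct vertices can be connected by a sequence of edges each intersecting the next; every hypergraph is uniquely partitioned into connected components. A monochromatic component of $H$ is (the vertex set of) a connected component of $H_i$ for some color $i$. Let $c(H)$ be the minimum integer $m$ such that $V(H)$ can be covered by $m$ monochromatic components of $H$. $\mathrm{cov}(r,k)$ is the maximum of $c(K)$ when $K$ ranges over all spanning $k$-colorings of complete $r$-uniform $r$-partite hypergraphs. -}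

module Defs where

open import Level using (0ℓ)
open import Data.Nat.Base using (ℕ; _≤_)
open import Data.Fin.Base using (Fin)
open import Data.Fin.Subset using (Subset; _∈_; _∩_; Nonempty)
open import Data.Product.Base using (Σ-syntax; ∃; ∃₂; ∃-syntax; _×_; proj₁)
open import Data.Product using (∃!)
open import Data.Sum.Base using (_⊎_)
open import Function.Definitions using (Surjective)
open import Relation.Binary.Core using (Rel)
open import Relation.Binary.Construct.Closure.ReflexiveTransitive using (Star)
open import Relation.Binary.PropositionalEquality.Core using (_≡_)
open import Relation.Unary using (Pred)

record Hypergraph : Set₁ where
  field
    order  : ℕ
    IsEdge : Pred (Subset order) 0ℓ

  Vertex : Set
  Vertex = Fin order

  Edge : Set
  Edge = ∃ IsEdge

  Intersects : Rel Edge 0ℓ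
  Intersects e f = Nonempty (proj₁ e ∩ proj₁ f)

  -- A nonempty sequence of edges, each intersecting the next, whose first
  -- edge contains u and whose last edge contains v.
  Linked : Rel Vertex 0ℓ
  Linked u v = ∃₂ λ (e f : Edge) → u ∈ proj₁ e × v ∈ proj₁ f × Star Intersects e f

  -- The connected component containing v.  The first alternative is needed
  -- because a vertex lying in no edge is a component by itself.
  Component : Vertex → Pred Vertex 0ℓ
  Component v w = v ≡ w ⊎ Linked v w

open Hypergraph public using (order; IsEdge; Vertex; Edge; Linked; Component)

-- The edge proof is irrelevant, so a colour depends only on the vertex set of
-- the edge.
Colouring : Hypergraph → ℕ → Set
Colouring H k = (e : Subset (order H)) → .(IsEdge H e) → Fin k

module _ (H : Hypergraph) {k : ℕ} (χ : Colouring H k) where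

  monochromatic : Fin k → Hypergraph
  monochromatic i = record
    { order  = order H
    ; IsEdge = λ e → Σ[ p ∈ IsEdge H e ] χ e p ≡ i
    }

  Spanning : Set
  Spanning = ∀ i → Edge (monochromatic i) →
             ∀ v → ∃[ e ] IsEdge (monochromatic i) e × v ∈ e

  -- A monochromatic component is given by a colour together with one of the
  -- component's vertices.  Repetitions in the family are harmless, since only
  -- the least possible m is used.
  CoverableBy : ℕ → Set
  CoverableBy m = Σ[ colour ∈ (Fin m → Fin k) ] Σ[ base ∈ (Fin m → Vertex H) ]
    (∀ v → ∃[ j ] Component (monochromatic (colour j)) (base j) v)

  -- c(H) = m
  IsC : ℕ → Set
  IsC m = CoverableBy m × (∀ m′ → CoverableBy m′ → m ≤ m′)

-- The classes V₁, …, V_r are the fibres of class; surjectivity says that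
-- they are nonempty.
record Partition (r : ℕ) : Set where
  field
    size       : ℕ
    class      : Fin size → Fin r
    surjective : Surjective _≡_ _≡_ class

completePartite : ∀ {r} → Partition r → Hypergraph
completePartite P = record
  { order  = size
  ; IsEdge = λ e → ∀ i → ∃! _≡_ λ v → v ∈ e × class v ≡ i
  }
  where open Partition P

-- cov(r,k) = m.  That c(K) exists for every spanning coloured K is part of
-- the first component: IsC is a relation, and a bound on only those values
-- that happen to exist would be weaker constructively.
IsCov : ℕ → ℕ → ℕ → Set
IsCov r k m =
  (∀ (P : Partition r) (χ : Colouring (completePartite P) k) →
     Spanning (completePartite P) χ →
     ∃[ c ] IsC (completePartite P) χ c × c ≤ m)
  ×
  (Σ[ P ∈ Partition r ] Σ[ χ ∈ Colouring (completePartite P) k ]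
     Spanning (completePartite P) χ × IsC (completePartite P) χ m)

{-# OPTIONS --safe #-}
-- Suppose no colour is connected.  By spanning, every component of a used
-- colour meets every class, so from any vertex and for any colour one can
-- find, in any other class, a vertex of a different component of that colour.
-- It suffices to pick a transversal of the classes not contained in a
-- component of any colour: as an edge, it could have no colour.  Choosing for
-- a fixed vertex x one further vertex per class separates r − 1 colours; the
-- r-th is gained by starting from two vertices separated in two colours at
-- once.  Such a pair exists among any u, v, w in three classes with u, v in
-- different components of the first colour and v, w of the second.
module Submission where

open import Defs
open import Data.Fin.Base using (Fin; zero; splitAt; _↑ˡ_)
open import Data.Fin.Patterns using (0F; 1F; 2F)
open import Data.Fin.Permutation using (Permutation′; _⟨$⟩ʳ_; _⟨$⟩ˡ_; inverseʳ; transpose)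
  renaming (id to idₚ)
open import Data.Fin.Properties using (_≟_; any?; all?; ¬∀⟶∃¬; splitAt-↑ˡ)
open import Data.Fin.Subset using (Subset; _∈_; _∉_; _∪_; ⁅_⁆; _⊃_)
open import Data.Fin.Subset.Induction using (Acc; acc; ⊃-wellFounded)
open import Data.Fin.Subset.Properties using
  (_∈?_; anySubset?; x∈⁅x⁆; x∈⁅y⁆⇒x≡y; x∈p∪q⁺; x∈p∪q⁻; x∈p∩q⁺; p⊆p∪q)
open import Data.Nat.Base using (ℕ; zero; suc; _+_; _≤_; z≤n; s≤s)
open import Data.Nat.Properties using (m≤n⇒∃[o]m+o≡n; ≤-refl)
open import Data.Product.Base using (Σ-syntax; ∃; ∃₂; ∃-syntax; _×_; _,_; proj₁; proj₂)
open import Data.Sum.Base using (inj₁; inj₂; [_,_]′)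
open import Data.Vec.Base using (tabulate)
open import Data.Vec.Properties using (lookup∘tabulate; lookup⇒[]=; []=⇒lookup)
open import Function.Base using (id; const; _∘_)
open import Level using (0ℓ)
open import Relation.Binary.Construct.Closure.ReflexiveTransitive
  using (Star; ε; _◅_; _◅◅_; reverse; return)
open import Relation.Binary.Core using (Rel)
open import Relation.Binary.Definitions using (Decidable)
open import Relation.Binary.PropositionalEquality
  using (_≡_; _≢_; refl; sym; trans; cong; subst; subst₂)
open import Relation.Binary.Structures using (IsDecEquivalence)
open import Relation.Nullary using (¬_; Dec; yes; no; contradiction)
open import Relation.Nullary.Decidable
  using (map′; _×-dec_; _→-dec_; ¬?; does; dec-true; decidable-stable)
import Relation.Unary as Unary

-- Finite preliminaries: decidable reachability, surjections

module _ {n} {R : Rel (Fin n) 0ℓ} (R? : Decidable R) where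

  private
    closed⇒Star⊆ : ∀ {S : Subset n} → ¬ (∃₂ λ u w → u ∈ S × w ∉ S × R u w) →
                   ∀ {u w} → u ∈ S → Star R u w → w ∈ S
    closed⇒Star⊆ closed u∈S ε = u∈S
    closed⇒Star⊆ {S} closed {u} u∈S (_◅_ {j = v} uRv v⋆w) =
      closed⇒Star⊆ closed (decidable-stable (v ∈? S) λ v∉S → closed (u , v , u∈S , v∉S , uRv)) v⋆w

    -- As long as some step leaves `S`, its endpoint is added; this stops because subsets of a
    -- finite set cannot grow forever. Once no step leaves `S`, it is the set of all vertices
    -- reachable from `v`, and membership decides.
    grow : ∀ v {S : Subset n} → v ∈ S → (∀ {w} → w ∈ S → Star R v w) →
           Acc _⊃_ S → ∀ w → Dec (Star R v w)
    grow v {S} v∈S reach (acc rec) w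
      with any? (λ x → any? λ y → (x ∈? S) ×-dec ¬? (y ∈? S) ×-dec R? x y)
    ... | no closed = map′ reach (closed⇒Star⊆ closed v∈S) (w ∈? S)
    ... | yes (x , y , x∈S , y∉S , xRy) =
      grow v (p⊆p∪q ⁅ y ⁆ v∈S) reach′
        (rec (p⊆p∪q ⁅ y ⁆ , y , x∈p∪q⁺ (inj₂ (x∈⁅x⁆ y)) , y∉S)) w
      where
      reach′ : ∀ {z} → z ∈ S ∪ ⁅ y ⁆ → Star R v z
      reach′ z∈ with x∈p∪q⁻ S ⁅ y ⁆ z∈
      ... | inj₁ z∈S = reach z∈S
      ... | inj₂ z∈y = subst (Star R v) (sym (x∈⁅y⁆⇒x≡y y z∈y)) (reach x∈S ◅◅ return xRy)

  star? : Decidable (Star R)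
  star? v = grow v (x∈⁅x⁆ v) (λ w∈ → subst (Star R v) (sym (x∈⁅y⁆⇒x≡y v w∈)) ε) (⊃-wellFounded _)

surjection : ∀ {k r} → 1 ≤ k → k ≤ r → Σ[ f ∈ (Fin r → Fin k) ] (∀ i → ∃[ m ] f m ≡ i)
surjection {suc k} _ k≤r with m≤n⇒∃[o]m+o≡n k≤r
-- The `o` surplus indices all go to `zero`; any value would do.
... | o , refl = [ id , const zero ]′ ∘ splitAt (suc k) ,
                 λ i → i ↑ˡ o , cong [ id , const zero ]′ (splitAt-↑ˡ (suc k) i o)

-- Transversals split by every relation

module _ {V : Set} {r} (class : V → Fin r) where

  IsTransversal : (Fin r → V) → Set
  IsTransversal f = ∀ c → class (f c) ≡ c

  CanAvoid : Rel V 0ℓ → Set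
  CanAvoid R = ∀ v {c} → class v ≢ c → ∃[ x ] class x ≡ c × ¬ R v x

  SplitBy : (Fin r → V) → Rel V 0ℓ → Set
  SplitBy f R = ∃₂ λ a b → ¬ R (f a) (f b)

  -- π says which relation the vertex chosen in a given class has to take care
  -- of; class x is free, as the pair x, y takes care of the relation i.
  extendPair : (R : Fin r → Rel V 0ℓ) → (∀ i → CanAvoid (R i)) →
               (π : Permutation′ r) → ∀ {i j} → i ≢ j →
               ∀ {x y} → π ⟨$⟩ʳ class x ≡ i → π ⟨$⟩ʳ class y ≡ j →
               ¬ R i x y → ¬ R j x y →
               ∃[ f ] IsTransversal f × (∀ m → SplitBy f (R m))
  extendPair R avoid π {i} {j} i≢j {x} {y} πx≡i πy≡j ¬Rixy ¬Rjxy =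
    proj₁ ∘ choose , proj₁ ∘ proj₂ ∘ choose , split
    where
    Choice : Fin r → V → Set
    Choice c z = class z ≡ c × (class x ≡ c → z ≡ x) × (class y ≡ c → z ≡ y) ×
                 (class x ≢ c → ¬ R (π ⟨$⟩ʳ c) x z)

    x≢y : class x ≢ class y
    x≢y eq = i≢j (trans (sym πx≡i) (trans (cong (π ⟨$⟩ʳ_) eq) πy≡j))

    choose : ∀ c → ∃ (Choice c)
    choose c with class x ≟ c | class y ≟ c
    ... | yes refl | _ = x , refl , (λ _ → refl) , (λ eq → contradiction (sym eq) x≢y) ,
                         (λ x≢x → contradiction refl x≢x)
    -- In the class of `y` there is nothing left to choose: the relation assigned to it is `j`,
    -- which already separates `x` from `y`.
    ... | no x≢c | yes refl = y , refl , (λ eq → contradiction eq x≢c) , (λ _ → refl) ,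
                              (λ _ → subst (λ m → ¬ R m x y) (sym πy≡j) ¬Rjxy)
    ... | no x≢c | no y≢c with avoid (π ⟨$⟩ʳ c) x x≢c
    ...   | z , z∈c , ¬Rxz = z , z∈c , (λ eq → contradiction eq x≢c) ,
                             (λ eq → contradiction eq y≢c) , (λ _ → ¬Rxz)

    f : Fin r → V
    f = proj₁ ∘ choose

    fx≡x : f (class x) ≡ x
    fx≡x = proj₁ (proj₂ (proj₂ (choose (class x)))) refl

    fy≡y : f (class y) ≡ y
    fy≡y = proj₁ (proj₂ (proj₂ (proj₂ (choose (class y))))) refl

    split : ∀ m → SplitBy f (R m)
    split m with class x ≟ π ⟨$⟩ˡ m
    -- The class assigned to `m` is that of `x`, which forces `m` to be `i`.
    ... | yes x≡c rewrite trans (sym (inverseʳ π)) (trans (cong (π ⟨$⟩ʳ_) (sym x≡c)) πx≡i) =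
      class x , class y , subst₂ (λ a b → ¬ R i a b) (sym fx≡x) (sym fy≡y) ¬Rixy
    ... | no x≢c = class x , π ⟨$⟩ˡ m ,
      subst₂ (λ l a → ¬ R l a (f (π ⟨$⟩ˡ m))) (inverseʳ π) (sym fx≡x)
        (proj₂ (proj₂ (proj₂ (proj₂ (choose (π ⟨$⟩ˡ m))))) x≢c)

splitTransversal : ∀ {V : Set} {n} (class : V → Fin (3 + n)) → ∃[ v ] class v ≡ 0F →
                   (R : Fin (3 + n) → Rel V 0ℓ) →
                   (∀ i → IsDecEquivalence (R i)) → (∀ i → CanAvoid class (R i)) →
                   ∃[ f ] IsTransversal class f × (∀ i → SplitBy class f (R i))
splitTransversal class (u , u∈0) R equiv avoid
  with avoid 0F u {1F} (λ eq → contradiction (trans (sym u∈0) eq) λ ())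
... | v , v∈1 , ¬R₀uv with avoid 1F v {2F} (λ eq → contradiction (trans (sym v∈1) eq) λ ())
...   | w , w∈2 , ¬R₁vw with IsDecEquivalence._≟_ (equiv 1F) u v | IsDecEquivalence._≟_ (equiv 0F) w v
-- In each case the permutation sends the classes of the doubly separated pair to `0F` and `1F`, in
-- this order.
...     | no ¬R₁uv | _ =
  extendPair class R avoid idₚ (λ ()) u∈0 v∈1 ¬R₀uv ¬R₁uv
...     | yes _ | no ¬R₀wv =
  extendPair class R avoid (transpose 0F 2F) (λ ())
    (cong (transpose 0F 2F ⟨$⟩ʳ_) w∈2) (cong (transpose 0F 2F ⟨$⟩ʳ_) v∈1)
    ¬R₀wv (¬R₁vw ∘ IsDecEquivalence.sym (equiv 1F))
-- Relating `u` to `w` would relate `u` to `v` in relation `0F` by way of `w`, or `v` to `w` in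
-- relation `1F` by way of `u`.
...     | yes R₁uv | yes R₀wv =
  extendPair class R avoid (transpose 1F 2F) (λ ())
    (cong (transpose 1F 2F ⟨$⟩ʳ_) u∈0) (cong (transpose 1F 2F ⟨$⟩ʳ_) w∈2)
    (λ R₀uw → ¬R₀uv (IsDecEquivalence.trans (equiv 0F) R₀uw R₀wv))
    (λ R₁uw → ¬R₁vw (IsDecEquivalence.trans (equiv 1F) (IsDecEquivalence.sym (equiv 1F) R₁uv) R₁uw))

-- Connectivity in a hypergraph

module _ (H : Hypergraph) where

  -- Paths run through vertices instead of edges, so that reachability is over a `Fin` and `star?`
  -- applies.
  Adjacent : Rel (Vertex H) 0ℓ
  Adjacent u v = ∃[ e ] IsEdge H e × u ∈ e × v ∈ e

  Connected : Rel (Vertex H) 0ℓ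
  Connected = Star Adjacent

  Connected⇒Component : ∀ {u v} → Connected u v → Component H u v
  Connected⇒Component ε = inj₁ refl
  Connected⇒Component ((e , p , u∈e , w∈e) ◅ path) with Connected⇒Component path
  ... | inj₁ refl = inj₂ ((e , p) , (e , p) , u∈e , w∈e , ε)
  ... | inj₂ (e′ , f , w∈e′ , v∈f , link) =
    inj₂ ((e , p) , f , u∈e , v∈f , (_ , x∈p∩q⁺ (w∈e , w∈e′)) ◅ link)

  connectedIsDecEquivalence : Unary.Decidable (IsEdge H) → IsDecEquivalence Connected
  connectedIsDecEquivalence edge? = record
    { isEquivalence = record
      { refl  = ε
      ; sym   = reverse λ (e , p , u∈e , v∈e) → e , p , v∈e , u∈e
      ; trans = _◅◅_
      }
    ; _≟_ = star? λ u v → anySubset? λ e → edge? e ×-dec (u ∈? e) ×-dec (v ∈? e)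
    }

-- Transversals as edges, and spanning colourings

module _ {r} (P : Partition r) where
  open Partition P

  private
    K = completePartite P

  representative : ∀ c → ∃[ v ] class v ≡ c
  representative c with surjective c
  ... | v , v∈c = v , v∈c refl

  isEdge? : Unary.Decidable (IsEdge K)
  isEdge? e = all? λ i → any? λ v → ((v ∈? e) ×-dec (class v ≟ i)) ×-dec
    map′ (λ h {y} → h y) (λ h y → h {y})
      (all? λ y → ((y ∈? e) ×-dec (class y ≟ i)) →-dec (v ≟ y))

  -- For a transversal `f` this is its range: a value of `f` can only be attained at its own class,
  -- so a single test suffices.
  image : (Fin r → Vertex K) → Subset size
  image f = tabulate λ v → does (f (class v) ≟ v)

  ∈image⁺ : ∀ {f} → IsTransversal class f → ∀ c → f c ∈ image f
  ∈image⁺ {f} trans-f c = lookup⇒[]= (f c) (image f)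
    (trans (lookup∘tabulate _ (f c)) (dec-true (_ ≟ _) (cong f (trans-f c))))

  ∈image⁻ : ∀ f {v} → v ∈ image f → f (class v) ≡ v
  ∈image⁻ f {v} v∈
    with f (class v) ≟ v
       | trans (sym (lookup∘tabulate (λ u → does (f (class u) ≟ u)) v)) ([]=⇒lookup v∈)
  ... | yes eq | _ = eq
  ... | no _   | ()

  image-isEdge : ∀ {f} → IsTransversal class f → IsEdge K (image f)
  image-isEdge {f} trans-f c = f c , (∈image⁺ trans-f c , trans-f c) ,
    λ { (y∈ , refl) → ∈image⁻ f y∈ }

  module _ {k} (χ : Colouring K k) where

    private
      Kᵢ : Fin k → Hypergraph
      Kᵢ = monochromatic K χ

    monochromaticIsEdge? : ∀ i → Unary.Decidable (IsEdge (Kᵢ i))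
    monochromaticIsEdge? i e with isEdge? e
    ... | no ¬p = no (¬p ∘ proj₁)
    ... | yes p = map′ (p ,_) proj₂ (χ e p ≟ i)

    equiv : ∀ i → IsDecEquivalence (Connected (Kᵢ i))
    equiv i = connectedIsDecEquivalence (Kᵢ i) (monochromaticIsEdge? i)

    connected? : ∀ i → Decidable (Connected (Kᵢ i))
    connected? i = IsDecEquivalence._≟_ (equiv i)

    module _ (spanning : Spanning K χ) where

      -- Not both `u` and `w` are connected to `v`, so some `z` is not. An edge of colour `i`
      -- through `z` meets class `c` in a vertex connected to `z`, hence not to `v`.
      disconnected⇒canAvoid : ∀ {i u w} → ¬ Connected (Kᵢ i) u w →
                              CanAvoid class (Connected (Kᵢ i))
      disconnected⇒canAvoid {i} {u} {w} ¬u~w v {c} v∉c = avoiding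
        where
        open IsDecEquivalence (equiv i) using () renaming (sym to ~-sym)

        far : ∃[ z ] ¬ Connected (Kᵢ i) v z
        far with connected? i v u
        ... | yes v~u = w , λ v~w → ¬u~w (~-sym v~u ◅◅ v~w)
        ... | no ¬v~u = u , ¬v~u

        viaEdge : Edge (Kᵢ i) → ∃[ x ] class x ≡ c × ¬ Connected (Kᵢ i) v x
        viaEdge e₀ with far
        ... | z , ¬v~z with spanning i e₀ z
        ...   | e , (p , χe≡i) , z∈e with p c
        ...     | x , (x∈e , x∈c) , _ =
          x , x∈c , λ v~x → ¬v~z (v~x ◅◅ return (e , (p , χe≡i) , x∈e , z∈e))

        avoiding : ∃[ x ] class x ≡ c × ¬ Connected (Kᵢ i) v x
        avoiding with representative c
        ... | x , x∈c with connected? i v x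
        -- Spanning says nothing about a colour without edges. Either the representative of `c`
        -- already avoids `v`, or a path to it supplies an edge of colour `i`; the path is nonempty
        -- because `v` lies outside `c`.
        ...   | no ¬v~x               = x , x∈c , ¬v~x
        ...   | yes ε                 = contradiction x∈c v∉c
        ...   | yes ((e , p , _) ◅ _) = viaEdge (e , p)

-- A connected colour, and the value of cov

transversalNotSplit : ∀ {r} (P : Partition r) {k} (χ : Colouring (completePartite P) k) →
  ∀ {f} → IsTransversal (Partition.class P) f →
  ¬ (∀ i → SplitBy (Partition.class P) f (Connected (monochromatic (completePartite P) χ i)))
transversalNotSplit P χ {f} trans-f split
  with split (χ (image P f) (image-isEdge P trans-f))
... | a , b , ¬a~b = ¬a~b (return
  (image P f , (image-isEdge P trans-f , refl) , ∈image⁺ P trans-f a , ∈image⁺ P trans-f b))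

connectedColour : ∀ {n k} → 1 ≤ k → k ≤ 3 + n → (P : Partition (3 + n)) →
  (χ : Colouring (completePartite P) k) → Spanning (completePartite P) χ →
  ∃₂ λ i u → ∀ v → Connected (monochromatic (completePartite P) χ i) u v
connectedColour {n} {k} 1≤k k≤r P χ spanning =
  -- Everything is finite and decidable, so refuting the absence of a connected colour produces one.
  decidable-stable (any? λ i → any? λ u → all? (connected? P χ i u)) λ ¬connected →
    let f , f-transversal , split =
          splitTransversal class (representative P 0F) (ConnectedBy ∘ colour)
            (equiv P χ ∘ colour) (canAvoid ¬connected ∘ colour)
    in transversalNotSplit P χ f-transversal λ i →
         subst (SplitBy class f ∘ ConnectedBy) (proj₂ (colour-surjective i))
           (split (proj₁ (colour-surjective i)))
  where
  open Partition P

  ConnectedBy : Fin k → Rel (Fin size) 0ℓ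
  ConnectedBy i = Connected (monochromatic (completePartite P) χ i)

  -- Repeating a colour reduces to the case of exactly r colours.
  colour : Fin (3 + n) → Fin k
  colour = proj₁ (surjection 1≤k k≤r)

  colour-surjective : ∀ i → ∃[ m ] colour m ≡ i
  colour-surjective = proj₂ (surjection 1≤k k≤r)

  canAvoid : ¬ (∃₂ λ i u → ∀ v → ConnectedBy i u v) → ∀ i → CanAvoid class (ConnectedBy i)
  canAvoid ¬connected i =
    let u , _ = representative P 0F
        _ , ¬u~w = ¬∀⟶∃¬ size (ConnectedBy i u) (connected? P χ i u) λ u~ → ¬connected (i , u , u~)
    in disconnected⇒canAvoid P χ spanning ¬u~w

isC-1 : ∀ {n k} → 1 ≤ k → k ≤ 3 + n → (P : Partition (3 + n)) →
  (χ : Colouring (completePartite P) k) → Spanning (completePartite P) χ →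
  IsC (completePartite P) χ 1
isC-1 1≤k k≤r P χ spanning =
  let i , u , u~ = connectedColour 1≤k k≤r P χ spanning
  in (const i , const u , λ v → 0F , Connected⇒Component _ (u~ v)) , minimal
  where
  minimal : ∀ m → CoverableBy (completePartite P) χ m → 1 ≤ m
  minimal (suc m) _ = s≤s z≤n
  -- An empty family would have to cover the representative of class `0F`.
  minimal zero (_ , _ , cover) with () ← proj₁ (cover (proj₁ (representative P 0F)))

discrete : ∀ r → Partition r
discrete r = record { size = r ; class = id ; surjective = λ c → c , id }

-- With singleton classes the only edge is the whole vertex set, so an edge of colour `i` passes
-- through every vertex.
discrete-spanning : ∀ {r k} (χ : Colouring (completePartite (discrete r)) k) →
                    Spanning (completePartite (discrete r)) χ
discrete-spanning χ i (e , (p , χe≡i)) v with p v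
... | _ , (v∈e , refl) , _ = e , (p , χe≡i) , v∈e

theorem1p2 : (r k : ℕ) → 3 ≤ r → 1 ≤ k → k ≤ r → IsCov r k 1
theorem1p2 (suc (suc (suc n))) (suc k) (s≤s (s≤s (s≤s _))) 1≤k k≤r =
  (λ P χ spanning → 1 , isC-1 1≤k k≤r P χ spanning , ≤-refl) ,
  discrete _ , constant , discrete-spanning constant ,
  isC-1 1≤k k≤r (discrete _) constant (discrete-spanning constant)
  where
  constant : Colouring (completePartite (discrete (3 + n))) (suc k)
  constant _ _ = zero
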